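{- Let $\Sigma$ be a finite predictive theory and $A \Rightarrow B$ a predictive formula. Then the procedure PseudoLinClosure executed with arguments $\Sigma$, $A$ and $\mathit{Max} = u(B)$ terminates after finitely many steps, and for its returned value $M$ we have $\Sigma \vdash A \Rightarrow B$ if and only if $B \subseteq M$.
   Context: $Y$ is a non-empty finite set of attributes and $\mathcal{T}_Y = \{y^i \mid y \in Y, i \in \mathbb{Z}\}$; $M + j = \{y^{i+j} \mid y^i \in M\}$. A formula is $A \Rightarrow B$ with $A,B$ finite subsets of $\mathcal{T}_Y$; a theory is a set of formulas. For finite non-empty $M$, $l(M) = \min\{i \mid y^i \in M\}$, $u(M) = \max\{i \mid y^i \in M\}$. $A \Rightarrow B$ is predictive if $A,B \neq \emptyset$ and $i \le j$ for all $x^i \in A$, $y^j \in B$; a theory is predictive if all its formulas are. Deduction rules (for finite $A,B,C,D$, $i \in \mathbb{Z}$): (Ax) infer $A \cup B \Rightarrow A$; (Cut) from $A \Rightarrow B$ and $B \cup C \Rightarrow D$ infer $A \cup C \Rightarrow D$; (Shf) from $A \Rightarrow B$ infer $A+i \Rightarrow B+i$; $\Sigma \vdash A \Rightarrow B$ means a finite sequence ending with $A \Rightarrow B$ exists whose members are in $\Sigma$ or follow from earlier members by these rules. Procedure PseudoLinClosure$(\Sigma, A, \mathit{Max})$: for every $E \Rightarrow F \in \Sigma$ and every integer $i$ with $l(A)-l(E) \le i \le \mathit{Max}-l(F)$, set $\mathit{count}[E \Rightarrow F, i] := |E|$ and, for every $y^j \in E$, add the pair $\langle E \Rightarrow F,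 i\rangle$ to the list $\mathit{list}[y^{i+j}]$ (all lists initially empty). Set $M := A$ and $\mathit{update} := A$. While $\mathit{update} \neq \emptyset$: choose $y^i \in \mathit{update}$, remove it from $\mathit{update}$, and for every $\langle E \Rightarrow F, j\rangle \in \mathit{list}[y^i]$ decrement $\mathit{count}[E \Rightarrow F, j]$ by one; if it becomes $0$, put $\mathit{new} := (F+j) \setminus M$, $M := M \cup \mathit{new}$, $\mathit{update} := \mathit{update} \cup \mathit{new}$. Finally return $M$. -}

module Defs where

open import Data.Fin.Base using (Fin)
import Data.Fin.Properties as Fin
open import Data.Integer.Base using (ℤ; +_; 0ℤ; ∣_∣; _+_; _-_; _≤_)
import Data.Integer.Properties as ℤ
open import Data.List.Base
  using (List; []; _∷_; _++_; map; filter; foldl; concatMap; length; upTo; deduplicate)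
open import Data.List.Extrema ℤ.≤-totalOrder using (min; max)
open import Data.List.Membership.Propositional using (_∈_)
import Data.List.Membership.DecPropositional as DecMembership
import Data.List.Properties as List
open import Data.List.Relation.Binary.BagAndSetEquality using (_∼[_]_; set)
open import Data.List.Relation.Binary.Permutation.Propositional using (_↭_)
import Data.List.Relation.Binary.Subset.DecPropositional as DecSubset
open import Data.List.Relation.Unary.Any using (Any)
open import Data.Nat.Base as ℕ using (ℕ; suc; pred)
open import Data.Product.Base using (_×_; _,_; proj₂; ∃; uncurry)
import Data.Product.Properties as Product
open import Function.Base using (flip)
open import Function.Bundles using (mk⇔; module Equivalence)
open import Induction.WellFounded using (Acc)
open import Level using (0ℓ)
open import Relation.Binary.Construct.Closure.ReflexiveTransitive using (Star)
open import Relation.Binary.Definitions using (Decidable; DecidableEquality)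
open import Relation.Binary.PropositionalEquality using (_≡_; _≢_; refl; cong₂)
open import Relation.Nullary.Decidable using (Dec; yes; no; map′; ¬?; _×-dec_)
open import Relation.Unary using (Pred)

-- The attributes are the elements of Fin n; (y , i) stands for yⁱ.
Timed : ℕ → Set
Timed n = Fin n × ℤ

-- A list stands for the finite set of its members: order and repetitions
-- carry no meaning, so equality of sets is _∼[ set ]_, not _≡_.
FinSet : ℕ → Set
FinSet n = List (Timed n)

infix  4 _≟_ _∈?_ _≟ˢ_
infixr 6 _∪_
infixl 6 _∖_ _⊕_

_≟_ : ∀ {n} → DecidableEquality (Timed n)
_≟_ = Product.≡-dec Fin._≟_ ℤ._≟_

_∈?_ : ∀ {n} (t : Timed n) (M : FinSet n) → Dec (t ∈ M)
_∈?_ = DecMembership._∈?_ _≟_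

_≟ˢ_ : ∀ {n} (M N : FinSet n) → Dec (M ∼[ set ] N)
M ≟ˢ N = map′ to from (M ⊆? N ×-dec N ⊆? M)
  where
  open DecSubset _≟_ using (_⊆_; _⊆?_)

  to : M ⊆ N × N ⊆ M → M ∼[ set ] N
  to (M⊆N , N⊆M) = mk⇔ M⊆N N⊆M

  from : M ∼[ set ] N → M ⊆ N × N ⊆ M
  from M∼N = Equivalence.to M∼N , Equivalence.from M∼N

_∪_ : ∀ {n} → FinSet n → FinSet n → FinSet n
_∪_ = _++_

_∖_ : ∀ {n} → FinSet n → FinSet n → FinSet n
M ∖ N = filter (λ t → ¬? (t ∈? N)) M

-- M ⊕ j is the translate M + j.
_⊕_ : ∀ {n} → FinSet n → ℤ → FinSet n
M ⊕ j = map (λ (y , i) → y , i + j) M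

card : ∀ {n} → FinSet n → ℕ
card M = length (deduplicate _≟_ M)

-- l and u are meaningful for non-empty sets only; 0ℤ is a junk value.
l u : ∀ {n} → FinSet n → ℤ
l []            = 0ℤ
l ((_ , i) ∷ M) = min i (map proj₂ M)
u []            = 0ℤ
u ((_ , i) ∷ M) = max i (map proj₂ M)

infix 4 _⇒_
record Formula (n : ℕ) : Set where
  constructor _⇒_
  field
    antecedent consequent : FinSet n

infix 4 _≈_ _≈?_ _≟ᶠ_ _∈≈_

_≈_ : ∀ {n} → Formula n → Formula n → Set
(A ⇒ B) ≈ (C ⇒ D) = A ∼[ set ] C × B ∼[ set ] D

_≈?_ : ∀ {n} → Decidable (_≈_ {n})
(A ⇒ B) ≈? (C ⇒ D) = A ≟ˢ C ×-dec B ≟ˢ D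

_≟ᶠ_ : ∀ {n} → DecidableEquality (Formula n)
(A ⇒ B) ≟ᶠ (C ⇒ D) =
  map′ (uncurry (cong₂ _⇒_)) (λ { refl → refl , refl })
       (List.≡-dec _≟_ A C ×-dec List.≡-dec _≟_ B D)

Theory : ℕ → Set₁
Theory n = Pred (Formula n) 0ℓ

⟦_⟧ : ∀ {n} → List (Formula n) → Theory n
⟦ Σ ⟧ φ = φ ∈ Σ

Predictive : ∀ {n} → Formula n → Set
Predictive (A ⇒ B) =
  A ≢ [] × B ≢ [] × (∀ {x i y j} → (x , i) ∈ A → (y , j) ∈ B → i ≤ j)

PredictiveTheory : ∀ {n} → Theory n → Set
PredictiveTheory T = ∀ φ → T φ → Predictive φ

_∈≈_ : ∀ {n} → Formula n → List (Formula n) → Set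
φ ∈≈ φs = Any (φ ≈_) φs

-- The formulas allowed to follow the members of φs in a proof from T.  Formulas
-- are compared by _≈_, so the rules do not depend on how sets are listed.
data Justified {n} (T : Theory n) (φs : List (Formula n)) : Formula n → Set where
  hyp : ∀ {φ ψ} → T ψ → φ ≈ ψ → Justified T φs φ
  ax  : ∀ {φ} A B → φ ≈ (A ∪ B ⇒ A) → Justified T φs φ
  cut : ∀ {φ} A B C D → (A ⇒ B) ∈≈ φs → (B ∪ C ⇒ D) ∈≈ φs →
        φ ≈ (A ∪ C ⇒ D) → Justified T φs φ
  shf : ∀ {φ} A B i → (A ⇒ B) ∈≈ φs → φ ≈ (A ⊕ i ⇒ B ⊕ i) → Justified T φs φ

-- Proofs are listed in reverse: the head is the last formula of the sequence.
infixr 5 _∷_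
data IsProof {n} (T : Theory n) : List (Formula n) → Set where
  []  : IsProof T []
  _∷_ : ∀ {φ φs} → Justified T φs φ → IsProof T φs → IsProof T (φ ∷ φs)

infix 4 _⊢_
_⊢_ : ∀ {n} → Theory n → Formula n → Set
T ⊢ φ = ∃ λ φs → IsProof T (φ ∷ φs)

-- All integers i with a ≤ i ≤ b.
range : ℤ → ℤ → List ℤ
range a b with a ℤ.≤? b
... | yes _ = map (λ k → a + + k) (upTo (suc ∣ b - a ∣))
... | no  _ = []

module PseudoLinClosure {n} (Σ : List (Formula n)) (A : FinSet n) (Max : ℤ) where

  Pair : Set
  Pair = Formula n × ℤ

  _≟ᵖ_ : DecidableEquality Pair
  _≟ᵖ_ = Product.≡-dec _≟ᶠ_ ℤ._≟_

  -- The pairs ⟨ E ⇒ F , i ⟩ initialised by the procedure.  The list Σ may present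
  -- the same formula several times; as a set it contains it once.
  pairs : List Pair
  pairs = concatMap
    (λ { φ@(E ⇒ F) → map (φ ,_) (range (l A - l E) (Max - l F)) })
    (deduplicate _≈?_ Σ)

  list : Timed n → List Pair
  list t = filter (λ { ((E ⇒ _) , i) → t ∈? E ⊕ i }) pairs

  record State : Set where
    constructor state
    field
      count  : Pair → ℕ
      M      : FinSet n
      update : FinSet n

  -- Only the entries of count at members of pairs are ever consulted.
  initial : State
  initial = state (λ { ((E ⇒ _) , _) → card E }) A A

  _[_≔_] : (Pair → ℕ) → Pair → ℕ → (Pair → ℕ)
  (f [ p ≔ c ]) q with q ≟ᵖ p
  ... | yes _ = c
  ... | no  _ = f q

  visit : State → Pair → State
  visit (state count M update) p@((_ ⇒ F) , j) with pred (count p)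
  ... | 0         = state (count [ p ≔ 0 ]) (M ∪ new) (update ∪ new)
    where new = (F ⊕ j) ∖ M
  ... | c@(suc _) = state (count [ p ≔ c ]) M update

  -- One iteration of the while loop.  Both the choice of t and the order in which
  -- the entries of list t are treated are left open.
  infix 4 _⟶_
  data _⟶_ : State → State → Set where
    iterate : ∀ {count M update t ps} → t ∈ update → ps ↭ list t →
              state count M update ⟶
                foldl visit (state count M (update ∖ (t ∷ []))) ps

  -- Every execution is finite, whatever choices are made.
  Terminates : Set
  Terminates = Acc (flip _⟶_) initial

  Returns : FinSet n → Set
  Returns R = ∃ λ count → Star _⟶_ initial (state count R [])

{-# OPTIONS --safe #-}
-- Soundness: a time point enters M only as a member of A or as a conclusion of a
-- shifted formula of Σ all of whose premises are in M, so it follows from A.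
-- Completeness: when update is empty, M together with all time points later than
-- Max is a model of Σ and all its shifts.  Indeed, a shift F + i reaching down to
-- Max has, as Σ is predictive, all its premises E + i not later than Max, hence in
-- M; then (E ⇒ F , i) is among the pairs and has fired.  Deduction preserves such
-- models, and B contains no time point later than Max = u B.
-- The counters are controlled through the list of the time points already visited:
-- between two iterations, count [ E ⇒ F , i ] is the number of elements of E + i
-- outside it.  Every iteration makes it grow inside a fixed finite set, which
-- bounds the length of an execution.
module Submission where

open import Defs
open import Algebra.Properties.AbelianGroup using (xyx⁻¹≈y)
open import Data.Integer.Base using (ℤ; +_; 0ℤ; ∣_∣; _+_; _-_; -_; _≤_; _<_)
import Data.Integer.Properties as ℤ
open import Data.List.Base
  using (List; []; _∷_; _++_; map; foldl; length; upTo; deduplicate; concatMap)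
open import Data.List.Extrema ℤ.≤-totalOrder
  using (min≤⊤; min≤xs; argmin-sel; ⊥≤max; xs≤max)
open import Data.List.Membership.Propositional using (_∈_; _∉_; find; lose)
open import Data.List.Membership.Propositional.Properties
open import Data.List.Properties
  using (filter-accept; filter-reject; filter-all; filter-none; filter-some;
         length-map; ++-identityʳ)
open import Data.List.Relation.Binary.BagAndSetEquality using (_∼[_]_; set; [_]-Equality)
open import Data.List.Relation.Binary.Permutation.Propositional
  using (_↭_; ↭-refl; ↭-sym; ↭⇒↭ₛ)
open import Data.List.Relation.Binary.Permutation.Propositional.Properties
  using (∈-resp-↭)
import Data.List.Relation.Binary.Permutation.Setoid.Properties as Permutation
open import Data.List.Relation.Binary.Subset.Propositional using (_⊆_)
open import Data.List.Relation.Binary.Subset.Propositional.Properties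
  using (Any-resp-⊆; xs⊆xs++ys; xs⊆ys++xs; ∈-∷⁺ʳ; ⊆[]⇒≡[])
  renaming (map⁺ to ⊆-map⁺)
open import Data.List.Relation.Unary.All as All using (All; []; _∷_)
import Data.List.Relation.Unary.All.Properties as All
open import Data.List.Relation.Unary.AllPairs as AllPairs using ([]; _∷_)
import Data.List.Relation.Unary.AllPairs.Properties as AllPairs
open import Data.List.Relation.Unary.Any as Any using (here; there)
import Data.List.Relation.Unary.Any.Properties as Any
import Data.List.Relation.Unary.Unique.DecPropositional.Properties as DecUnique
import Data.List.Relation.Unary.Unique.DecSetoid.Properties as DecSetoidUnique
open import Data.List.Relation.Unary.Unique.Propositional using (Unique)
import Data.List.Relation.Unary.Unique.Propositional.Properties as Unique
open import Data.Nat.Base as ℕ using (ℕ; zero; suc; pred; s≤s; NonZero)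
import Data.Nat.Properties as ℕ
open import Data.Product.Base using (_×_; _,_; proj₁; proj₂; ∃)
open import Data.Product.Properties using (,-injectiveˡ; ,-injectiveʳ)
open import Data.Sum.Base using (_⊎_; inj₁; inj₂; [_,_]′)
open import Function.Base using (_∘_; id; flip)
open import Function.Bundles using (_⇔_; mk⇔; module Equivalence)
open import Induction.WellFounded using (Acc; acc)
open import Relation.Binary.Bundles using (DecSetoid; module Setoid)
open import Relation.Binary.Construct.Closure.ReflexiveTransitive using (Star; ε; _◅_)
open import Relation.Binary.PropositionalEquality
  using (_≡_; _≢_; refl; sym; trans; cong; subst; module ≡-Reasoning)
open import Relation.Binary.PropositionalEquality.Properties using (setoid)
open import Relation.Nullary.Decidable using (Dec; yes; no; ¬?)
open import Relation.Nullary.Negation using (¬_; contradiction)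

-- Integers

i≤j+k⇒i-j≤k : ∀ {i k} j → i ≤ j + k → i - j ≤ k
i≤j+k⇒i-j≤k {i} {k} j i≤j+k =
  subst (i - j ≤_) (xyx⁻¹≈y ℤ.+-0-abelianGroup j k) (ℤ.+-monoˡ-≤ (- j) i≤j+k)

i+j≤k⇒j≤k-i : ∀ {j k} i → i + j ≤ k → j ≤ k - i
i+j≤k⇒j≤k-i {j} {k} i i+j≤k =
  subst (_≤ k - i) (xyx⁻¹≈y ℤ.+-0-abelianGroup i j) (ℤ.+-monoˡ-≤ (- i) i+j≤k)

i+[j-i]≡j : ∀ i j → i + (j - i) ≡ j
i+[j-i]≡j i j = trans (sym (ℤ.+-assoc i j (- i))) (xyx⁻¹≈y ℤ.+-0-abelianGroup i j)

i-j≤k⇒i≤j+k : ∀ {i k} j → i - j ≤ k → i ≤ j + k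
i-j≤k⇒i≤j+k {i} {k} j i-j≤k = subst (_≤ j + k) (i+[j-i]≡j j i) (ℤ.+-monoʳ-≤ j i-j≤k)

+-cancelˡ : ∀ {j k} i → i + j ≡ i + k → j ≡ k
+-cancelˡ {j} {k} i eq = begin
  j          ≡⟨ xyx⁻¹≈y ℤ.+-0-abelianGroup i j ⟨
  i + j - i  ≡⟨ cong (_- i) eq ⟩
  i + k - i  ≡⟨ xyx⁻¹≈y ℤ.+-0-abelianGroup i k ⟩
  k          ∎
  where open ≡-Reasoning

range-unique : ∀ a b → Unique (range a b)
range-unique a b with a ℤ.≤? b
... | yes _ = Unique.map⁺ (ℤ.+-injective ∘ +-cancelˡ a) (Unique.upTo⁺ _)
... | no  _ = []

∈-range⁺ : ∀ {a b i} → a ≤ i → i ≤ b → i ∈ range a b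
∈-range⁺ {a} {b} {i} a≤i i≤b with a ℤ.≤? b
... | no  a≰b = contradiction (ℤ.≤-trans a≤i i≤b) a≰b
-- `i` is the entry with index `∣ i - a ∣`. The `suc` in `range` makes the end point `b` count, as
-- `∈-upTo⁺` asks for a strict bound.
... | yes a≤b = subst (_∈ map (λ k → a + + k) (upTo (suc ∣ b - a ∣)))
                      (trans (cong (λ j → a + j) ∣i-a∣≡i-a) (i+[j-i]≡j a i))
                      (∈-map⁺ _ (∈-upTo⁺ (s≤s ∣i-a∣≤∣b-a∣)))
  where
  ∣i-a∣≡i-a : + ∣ i - a ∣ ≡ i - a
  ∣i-a∣≡i-a = ℤ.0≤i⇒+∣i∣≡i (ℤ.i≤j⇒0≤j-i a≤i)

  ∣i-a∣≤∣b-a∣ : ∣ i - a ∣ ℕ.≤ ∣ b - a ∣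
  ∣i-a∣≤∣b-a∣ = ℤ.drop‿+≤+ (begin
    + ∣ i - a ∣  ≡⟨ ∣i-a∣≡i-a ⟩
    i - a        ≤⟨ ℤ.+-monoˡ-≤ (- a) i≤b ⟩
    b - a        ≡⟨ ℤ.0≤i⇒+∣i∣≡i (ℤ.i≤j⇒0≤j-i a≤b) ⟨
    + ∣ b - a ∣  ∎)
    where open ℤ.≤-Reasoning

∈-range⇒≤ : ∀ {a b i} → i ∈ range a b → a ≤ i
∈-range⇒≤ {a} {b} i∈range with a ℤ.≤? b
∈-range⇒≤ i∈range | yes _ with ∈-map⁻ _ i∈range
... | k , _ , refl = ℤ.i≤i+j _ (+ k)
∈-range⇒≤ ()      | no _

-- Finite sets of time points

module _ {n : ℕ} where

  l-≤ : ∀ {M : FinSet n} {y i} → (y , i) ∈ M → l M ≤ i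
  l-≤ {_ ∷ M} (here refl) = min≤⊤ _ (map proj₂ M)
  l-≤ {_ ∷ M} (there t∈M) = All.lookup (min≤xs _ (map proj₂ M)) (∈-map⁺ proj₂ t∈M)

  l-∈ : ∀ {M : FinSet n} → M ≢ [] → ∃ λ y → (y , l M) ∈ M
  l-∈ {[]}          M≢[] = contradiction refl M≢[]
  l-∈ {(y , i) ∷ M} _    with argmin-sel id i (map proj₂ M)
  ... | inj₁ l≡i = y , here (cong (y ,_) l≡i)
  ... | inj₂ l∈  with ∈-map⁻ proj₂ l∈
  ... | (x , _) , x∈M , l≡j = x , there (subst (λ j → (x , j) ∈ M) (sym l≡j) x∈M)

  ≤-u : ∀ {M : FinSet n} {y i} → (y , i) ∈ M → i ≤ u M
  ≤-u {_ ∷ M} (here refl) = ⊥≤max _ (map proj₂ M)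
  ≤-u {_ ∷ M} (there t∈M) = All.lookup (xs≤max _ (map proj₂ M)) (∈-map⁺ proj₂ t∈M)

  ∈-⊕⁻ : ∀ {M : FinSet n} {i t} → t ∈ M ⊕ i →
         ∃ λ y → ∃ λ j → (y , j) ∈ M × t ≡ (y , j + i)
  ∈-⊕⁻ t∈M⊕i with ∈-map⁻ _ t∈M⊕i
  ... | (y , j) , y∈M , eq = y , j , y∈M , eq

  _∉?_ : ∀ (t : Timed n) (N : FinSet n) → Dec (t ∉ N)
  t ∉? N = ¬? (t ∈? N)

  ∈-∖⁺ : ∀ {M N : FinSet n} {t} → t ∈ M → t ∉ N → t ∈ M ∖ N
  ∈-∖⁺ = ∈-filter⁺ _

  ∈-∖⁻ : ∀ {M N : FinSet n} {t} → t ∈ M ∖ N → t ∈ M × t ∉ N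
  ∈-∖⁻ = ∈-filter⁻ _

  ∖-[] : ∀ (M : FinSet n) → M ∖ [] ≡ M
  ∖-[] M = filter-all (_∉? []) {M} (All.tabulate λ _ ())

  ∷-∖-∉ : ∀ {t} M {N : FinSet n} → t ∉ N → (t ∷ M) ∖ N ≡ t ∷ (M ∖ N)
  ∷-∖-∉ M {N} = filter-accept (_∉? N) {xs = M}

  ∷-∖-∈ : ∀ {t} M {N : FinSet n} → t ∈ N → (t ∷ M) ∖ N ≡ M ∖ N
  ∷-∖-∈ M {N} t∈N = filter-reject (_∉? N) {xs = M} (contradiction t∈N)

  ∖-∷-∉ : ∀ {t} {M N : FinSet n} → t ∉ M → M ∖ (t ∷ N) ≡ M ∖ N
  ∖-∷-∉ {t} {[]}    {N} _   = refl
  ∖-∷-∉ {t} {s ∷ M} {N} t∉M = go (s ∈? N)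
    where
    ih : M ∖ (t ∷ N) ≡ M ∖ N
    ih = ∖-∷-∉ (t∉M ∘ there)

    s∉t∷N : s ∉ N → s ∉ t ∷ N
    s∉t∷N s∉N (here refl)  = t∉M (here refl)
    s∉t∷N s∉N (there s∈N) = s∉N s∈N

    go : Dec (s ∈ N) → (s ∷ M) ∖ (t ∷ N) ≡ (s ∷ M) ∖ N
    go (yes s∈N) = trans (∷-∖-∈ M (there s∈N)) (trans ih (sym (∷-∖-∈ M s∈N)))
    go (no  s∉N) = trans (∷-∖-∉ M (s∉t∷N s∉N)) (trans (cong (s ∷_) ih) (sym (∷-∖-∉ M s∉N)))

  -- As `M` has no repetitions, exactly one entry is lost. This governs both the decrement of a
  -- counter by one and the decrease of the termination measure.
  length-∖-∷ : ∀ {t} {M N : FinSet n} → Unique M → t ∈ M → t ∉ N →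
               length (M ∖ N) ≡ suc (length (M ∖ (t ∷ N)))
  length-∖-∷ {t} {_ ∷ M} {N} M! (here refl) t∉N = begin
    length ((t ∷ M) ∖ N)              ≡⟨ cong length (∷-∖-∉ M t∉N) ⟩
    suc (length (M ∖ N))              ≡⟨ cong (suc ∘ length) (∖-∷-∉ t∉M) ⟨
    suc (length (M ∖ (t ∷ N)))        ≡⟨ cong (suc ∘ length) (∷-∖-∈ M (here refl)) ⟨
    suc (length ((t ∷ M) ∖ (t ∷ N)))  ∎
    where
    open ≡-Reasoning
    t∉M = Unique.Unique[x∷xs]⇒x∉xs M!
  length-∖-∷ {t} {s ∷ M} {N} M!@(_ ∷ M!′) (there t∈M) t∉N = go (s ∈? N)
    where
    ih : length (M ∖ N) ≡ suc (length (M ∖ (t ∷ N)))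
    ih = length-∖-∷ M!′ t∈M t∉N

    s∉t∷N : s ∉ N → s ∉ t ∷ N
    s∉t∷N s∉N (here refl)  = Unique.Unique[x∷xs]⇒x∉xs M! t∈M
    s∉t∷N s∉N (there s∈N) = s∉N s∈N

    go : Dec (s ∈ N) → length ((s ∷ M) ∖ N) ≡ suc (length ((s ∷ M) ∖ (t ∷ N)))
    go (yes s∈N) = trans (cong length (∷-∖-∈ M s∈N))
                         (trans ih (cong (suc ∘ length) (sym (∷-∖-∈ M (there s∈N)))))
    go (no  s∉N) = trans (cong length (∷-∖-∉ M s∉N))
                         (trans (cong suc ih)
                           (cong (suc ∘ length) (sym (∷-∖-∉ M (s∉t∷N s∉N)))))

  length-∖⇒⊆ : ∀ {M N : FinSet n} → length (M ∖ N) ≡ 0 → M ⊆ N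
  length-∖⇒⊆ {M} {N} eq {t} t∈M with t ∈? N
  ... | yes t∈N = t∈N
  ... | no  t∉N = contradiction (subst (0 ℕ.<_) eq (filter-some (_∉? N) (lose t∈M t∉N))) λ ()

  ⊆⇒length-∖ : ∀ {M N : FinSet n} → M ⊆ N → length (M ∖ N) ≡ 0
  ⊆⇒length-∖ {N = N} M⊆N =
    cong length (filter-none (_∉? N) (All.tabulate λ t∈M t∉N → t∉N (M⊆N t∈M)))

  ⊕-injective : ∀ {i} {s t : Timed n} →
                (proj₁ s , proj₂ s + i) ≡ (proj₁ t , proj₂ t + i) → s ≡ t
  ⊕-injective {i} {_ , j} {_ , k} eq with ,-injectiveˡ eq | ,-injectiveʳ eq
  ... | refl | j+i≡k+i = cong (_ ,_)
    (+-cancelˡ i (trans (ℤ.+-comm i j) (trans j+i≡k+i (ℤ.+-comm k i))))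

-- Deduction

module _ {n : ℕ} where

  private
    module ∼ = Setoid ([ set ]-Equality (Timed n))

  ⊆-antisym : ∀ {M N : FinSet n} → M ⊆ N → N ⊆ M → M ∼[ set ] N
  ⊆-antisym M⊆N N⊆M = mk⇔ M⊆N N⊆M

  ≈-refl : ∀ {φ : Formula n} → φ ≈ φ
  ≈-refl = ∼.refl , ∼.refl

  ≈-sym : ∀ {φ ψ : Formula n} → φ ≈ ψ → ψ ≈ φ
  ≈-sym (p , q) = ∼.sym p , ∼.sym q

  ≈-trans : ∀ {φ ψ χ : Formula n} → φ ≈ ψ → ψ ≈ χ → φ ≈ χ
  ≈-trans (p , q) (p′ , q′) = ∼.trans p p′ , ∼.trans q q′

  ≈-decSetoid : DecSetoid _ _
  ≈-decSetoid = record
    { Carrier          = Formula n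
    ; _≈_              = _≈_
    ; isDecEquivalence = record
      { isEquivalence = record
        { refl  = λ {φ} → ≈-refl {φ}
        ; sym   = λ {φ} {ψ} → ≈-sym {φ} {ψ}
        ; trans = λ {φ} {ψ} {χ} → ≈-trans {φ} {ψ} {χ} }
      ; _≟_ = _≈?_ } }

  -- Derived rules

  module _ {T : Theory n} where

    Justified-⊆ : ∀ {φs ψs φ} → φs ⊆ ψs → Justified T φs φ → Justified T ψs φ
    Justified-⊆ φs⊆ψs (hyp Tψ φ≈ψ)         = hyp Tψ φ≈ψ
    Justified-⊆ φs⊆ψs (ax A B eq)          = ax A B eq
    Justified-⊆ φs⊆ψs (cut A B C D p q eq) =
      cut A B C D (Any-resp-⊆ φs⊆ψs p) (Any-resp-⊆ φs⊆ψs q) eq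
    Justified-⊆ φs⊆ψs (shf A B i p eq)     = shf A B i (Any-resp-⊆ φs⊆ψs p) eq

    Justified-≈ : ∀ {φs φ ψ} → ψ ≈ φ → Justified T φs φ → Justified T φs ψ
    Justified-≈ {ψ = ψ} ψ≈φ (hyp {ψ = χ} Tχ φ≈χ) = hyp Tχ (≈-trans {ψ} {_} {χ} ψ≈φ φ≈χ)
    Justified-≈ {ψ = ψ} ψ≈φ (ax A B eq)          = ax A B (≈-trans {ψ} ψ≈φ eq)
    Justified-≈ {ψ = ψ} ψ≈φ (cut A B C D p q eq) = cut A B C D p q (≈-trans {ψ} ψ≈φ eq)
    Justified-≈ {ψ = ψ} ψ≈φ (shf A B i p eq)     = shf A B i p (≈-trans {ψ} ψ≈φ eq)

    IsProof-++ : ∀ {φs ψs} → IsProof T φs → IsProof T ψs → IsProof T (φs ++ ψs)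
    IsProof-++ []       q = q
    IsProof-++ (j ∷ p) q = Justified-⊆ (xs⊆xs++ys _ _) j ∷ IsProof-++ p q

    ⊢-resp-≈ : ∀ {φ ψ} → ψ ≈ φ → T ⊢ φ → T ⊢ ψ
    ⊢-resp-≈ ψ≈φ (φs , j ∷ p) = φs , Justified-≈ ψ≈φ j ∷ p

    ⊢-hyp : ∀ {φ} → T φ → T ⊢ φ
    ⊢-hyp {φ} Tφ = [] , hyp Tφ (≈-refl {φ}) ∷ []

    ⊢-⊆ : ∀ {A B} → B ⊆ A → T ⊢ (A ⇒ B)
    ⊢-⊆ {A} {B} B⊆A =
      [] , ax B A (⊆-antisym (xs⊆ys++xs A B) ([ B⊆A , id ]′ ∘ ∈-++⁻ B) , ∼.refl) ∷ []

    ⊢-shift : ∀ {A B} i → T ⊢ (A ⇒ B) → T ⊢ (A ⊕ i ⇒ B ⊕ i)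
    ⊢-shift {A} {B} i (_ , p) =
      _ , shf A B i (here (≈-refl {A ⇒ B})) (≈-refl {A ⊕ i ⇒ B ⊕ i}) ∷ p

    ⊢-cut : ∀ {A B C D} → T ⊢ (A ⇒ B) → T ⊢ (B ∪ C ⇒ D) → T ⊢ (A ∪ C ⇒ D)
    ⊢-cut {A} {B} {C} {D} (φs , p) (_ , q) = _ ,
      cut A B C D (here (≈-refl {A ⇒ B}))
        (Any.++⁺ʳ ((A ⇒ B) ∷ φs) (here (≈-refl {B ∪ C ⇒ D}))) (≈-refl {A ∪ C ⇒ D})
      ∷ IsProof-++ p q

    ⊢-trans : ∀ {A B C} → T ⊢ (A ⇒ B) → T ⊢ (B ⇒ C) → T ⊢ (A ⇒ C)
    ⊢-trans {A} {B} {C} p q =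
      subst (λ M → T ⊢ (M ⇒ C)) (++-identityʳ A)
        (⊢-cut p (subst (λ M → T ⊢ (M ⇒ C)) (sym (++-identityʳ B)) q))

    -- Cutting `A ⇒ B` into the axiom `B ∪ C ⇒ B ∪ C` gives `A ∪ C ⇒ B ∪ C`; cutting `A ⇒ C` into
    -- that, with the union commuted, leaves `A ∪ A` on the left, which is `A` as a set.
    ⊢-∪ : ∀ {A B C} → T ⊢ (A ⇒ B) → T ⊢ (A ⇒ C) → T ⊢ (A ⇒ B ∪ C)
    ⊢-∪ {A} {B} {C} p q =
      ⊢-resp-≈ {A ∪ A ⇒ B ∪ C} (⊆-antisym (xs⊆xs++ys A A) ([ id , id ]′ ∘ ∈-++⁻ A) , ∼.refl)
        (⊢-cut q (⊢-resp-≈ {A ∪ C ⇒ B ∪ C} (∪-comm C A , ∼.refl) (⊢-cut p (⊢-⊆ id))))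
      where
      ∪-comm : ∀ M N → M ∪ N ∼[ set ] N ∪ M
      ∪-comm M N = ⊆-antisym ([ ∈-++⁺ʳ N , ∈-++⁺ˡ ]′ ∘ ∈-++⁻ M)
                             ([ ∈-++⁺ʳ M , ∈-++⁺ˡ ]′ ∘ ∈-++⁻ N)

    ⊢-pointwise : ∀ {A} B → (∀ {t} → t ∈ B → T ⊢ (A ⇒ t ∷ [])) → T ⊢ (A ⇒ B)
    ⊢-pointwise []      _ = ⊢-⊆ λ ()
    ⊢-pointwise (t ∷ B) p = ⊢-∪ (p (here refl)) (⊢-pointwise B (p ∘ there))

  -- Semantics and soundness of the rules

  infix 4 _∶_⊨_ _⊨_

  -- `N` is a predicate rather than a `FinSet` because the model needed for completeness is
  -- infinite.
  _∶_⊨_ : (Timed n → Set) → ℤ → FinSet n → Set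
  N ∶ i ⊨ A = ∀ {y j} → (y , j) ∈ A → N (y , j + i)

  -- Quantifying over all translates builds closure under (Shf) into truth.
  _⊨_ : (Timed n → Set) → Formula n → Set
  N ⊨ (A ⇒ B) = ∀ i → N ∶ i ⊨ A → N ∶ i ⊨ B

  module _ {N : Timed n → Set} where

    ⊨-resp-≈ : ∀ {φ ψ} → φ ≈ ψ → N ⊨ ψ → N ⊨ φ
    ⊨-resp-≈ (A∼C , B∼D) N⊨ψ i N⊨A =
      N⊨ψ i (N⊨A ∘ Equivalence.from A∼C) ∘ Equivalence.to B∼D

    ∶-⊕⁺ : ∀ {A i k} → N ∶ k + i ⊨ A → N ∶ i ⊨ A ⊕ k
    ∶-⊕⁺ {i = i} {k} N⊨A t∈A⊕k with ∈-⊕⁻ t∈A⊕k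
    ... | y , j , y∈A , refl = subst (λ m → N (y , m)) (sym (ℤ.+-assoc j k i)) (N⊨A y∈A)

    ∶-⊕⁻ : ∀ {A i k} → N ∶ i ⊨ A ⊕ k → N ∶ k + i ⊨ A
    ∶-⊕⁻ {i = i} {k} N⊨A⊕k {y} {j} y∈A =
      subst (λ m → N (y , m)) (ℤ.+-assoc j k i) (N⊨A⊕k (∈-map⁺ _ y∈A))

    module _ {T : Theory n} (N⊨T : ∀ {φ} → T φ → N ⊨ φ) where

      private
        ⊨-lookup : ∀ {φ φs} → All (N ⊨_) φs → φ ∈≈ φs → N ⊨ φ
        ⊨-lookup {φ} N⊨φs φ∈≈φs with find φ∈≈φs
        ... | ψ , ψ∈φs , φ≈ψ = ⊨-resp-≈ {φ} {ψ} φ≈ψ (All.lookup N⊨φs ψ∈φs)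

      Justified-⊨ : ∀ {φs φ} → All (N ⊨_) φs → Justified T φs φ → N ⊨ φ
      Justified-⊨ {φ = φ} N⊨φs (hyp {ψ = ψ} Tψ φ≈ψ) = ⊨-resp-≈ {φ} {ψ} φ≈ψ (N⊨T Tψ)
      Justified-⊨ {φ = φ} N⊨φs (ax A B eq) =
        ⊨-resp-≈ {φ} {A ∪ B ⇒ A} eq λ _ N⊨A∪B → N⊨A∪B ∘ ∈-++⁺ˡ
      Justified-⊨ {φ = φ} N⊨φs (cut A B C D p q eq) =
        ⊨-resp-≈ {φ} {A ∪ C ⇒ D} eq λ i N⊨A∪C →
          ⊨-lookup {B ∪ C ⇒ D} N⊨φs q i λ y∈B∪C →
            [ ⊨-lookup {A ⇒ B} N⊨φs p i (N⊨A∪C ∘ ∈-++⁺ˡ) , N⊨A∪C ∘ ∈-++⁺ʳ A ]′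
              (∈-++⁻ B y∈B∪C)
      Justified-⊨ {φ = φ} N⊨φs (shf A B k p eq) =
        ⊨-resp-≈ {φ} {A ⊕ k ⇒ B ⊕ k} eq λ i N⊨A⊕k →
          ∶-⊕⁺ (⊨-lookup {A ⇒ B} N⊨φs p (k + i) (∶-⊕⁻ N⊨A⊕k))

      IsProof-⊨ : ∀ {φs} → IsProof T φs → All (N ⊨_) φs
      IsProof-⊨ []       = []
      IsProof-⊨ (j ∷ p) = Justified-⊨ (IsProof-⊨ p) j ∷ IsProof-⊨ p

      ⊢⇒⊨ : ∀ {φ} → T ⊢ φ → N ⊨ φ
      ⊢⇒⊨ (_ , p) = All.head (IsProof-⊨ p)

-- Executions of the procedure

module Execution {n : ℕ} (Σ : List (Formula n)) (A : FinSet n) (Max : ℤ) where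

  open PseudoLinClosure Σ A Max

  premise conclusion : Pair → FinSet n
  premise    ((E ⇒ _) , i) = E ⊕ i
  conclusion ((_ ⇒ F) , i) = F ⊕ i

  -- `pairs` is built from the theory deduplicated up to `_≈_`, so a given listing of a formula may
  -- be missing from it; another listing of the same formula is there.
  representative : ∀ {φ} → φ ∈ Σ → ∃ λ ψ → ψ ∈ deduplicate _≈?_ Σ × φ ≈ ψ
  representative {φ} φ∈Σ = find
    (Any.deduplicate⁺ _≈?_ {P = φ ≈_} resp (Any.map (λ { refl → ≈-refl {φ = φ} }) φ∈Σ))
    where
    resp : ∀ {ψ χ} → χ ≈ ψ → φ ≈ ψ → φ ≈ χ
    resp {ψ} {χ} χ≈ψ φ≈ψ = ≈-trans {φ = φ} {ψ} {χ} φ≈ψ (≈-sym {φ = χ} {ψ} χ≈ψ)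

  ∈-pairs⁺ : ∀ {E F i} → (E ⇒ F) ∈ deduplicate _≈?_ Σ →
             l A - l E ≤ i → i ≤ Max - l F → ((E ⇒ F) , i) ∈ pairs
  ∈-pairs⁺ φ∈ lower upper =
    ∈-concatMap⁺ _ (Any.map (λ { refl → ∈-map⁺ _ (∈-range⁺ lower upper) }) φ∈)

  ∈-pairs⁻ : ∀ {E F i} → ((E ⇒ F) , i) ∈ pairs → (E ⇒ F) ∈ Σ × l A - l E ≤ i
  ∈-pairs⁻ q∈pairs with find (∈-concatMap⁻ _ q∈pairs)
  ... | φ , φ∈ , q∈ with ∈-map⁻ (φ ,_) q∈
  ... | _ , i∈ , refl = ∈-deduplicate⁻ _≈?_ Σ φ∈ , ∈-range⇒≤ i∈

  -- A repeated pair would be decremented twice for one time point. Within a block the shifts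
  -- differ; distinct blocks belong to formulas that are not even equal up to `_≈_`.
  pairs-unique : Unique pairs
  pairs-unique = Unique.concat⁺
    (All.map⁺ (All.tabulate λ { {E ⇒ F} _ →
      Unique.map⁺ ,-injectiveʳ (range-unique (l A - l E) (Max - l F)) }))
    (AllPairs.map⁺ (AllPairs.map disjoint (DecSetoidUnique.deduplicate-! ≈-decSetoid Σ)))
    where
    disjoint : ∀ {φ ψ} {is js : List ℤ} → ¬ φ ≈ ψ →
               ∀ {q} → ¬ (q ∈ map (φ ,_) is × q ∈ map (ψ ,_) js)
    disjoint {φ} {ψ} φ≉ψ (q∈ , q∈′) with ∈-map⁻ (φ ,_) q∈ | ∈-map⁻ (ψ ,_) q∈′
    ... | _ , _ , refl | _ , _ , refl = φ≉ψ (≈-refl {φ = φ})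

  ∈-list⁺ : ∀ {t q} → q ∈ pairs → t ∈ premise q → q ∈ list t
  ∈-list⁺ = ∈-filter⁺ _

  ∈-list⁻ : ∀ {t q} → q ∈ list t → q ∈ pairs × t ∈ premise q
  ∈-list⁻ {t} = ∈-filter⁻ _ {xs = pairs}

  list-unique : ∀ t → Unique (list t)
  list-unique t = Unique.filter⁺ _ pairs-unique

  -- The value that the counter should have after the visits to `D`. Deduplicating `E` makes it
  -- start at `card E`, as `initial` does.
  remaining : FinSet n → Pair → ℕ
  remaining D ((E ⇒ _) , i) = length ((deduplicate _≟_ E ⊕ i) ∖ D)

  private
    premise⁺ : ∀ q {t} → t ∈ premise q →
               t ∈ deduplicate _≟_ (Formula.antecedent (proj₁ q)) ⊕ proj₂ q
    premise⁺ q = ⊆-map⁺ _ (∈-deduplicate⁺ _≟_)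

    premise⁻ : ∀ q {t} → t ∈ deduplicate _≟_ (Formula.antecedent (proj₁ q)) ⊕ proj₂ q →
               t ∈ premise q
    premise⁻ q = ⊆-map⁺ _ (∈-deduplicate⁻ _≟_ _)

  remaining-[] : ∀ E F i → remaining [] ((E ⇒ F) , i) ≡ card E
  remaining-[] E F i = begin
    length ((deduplicate _≟_ E ⊕ i) ∖ [])  ≡⟨ cong length (∖-[] (deduplicate _≟_ E ⊕ i)) ⟩
    length (deduplicate _≟_ E ⊕ i)         ≡⟨ length-map _ (deduplicate _≟_ E) ⟩
    length (deduplicate _≟_ E)             ∎
    where open ≡-Reasoning

  remaining-∷-∈ : ∀ {D t} q → t ∈ premise q → t ∉ D →
                  remaining D q ≡ suc (remaining (t ∷ D) q)
  remaining-∷-∈ q@((E ⇒ _) , _) t∈q =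
    length-∖-∷ (Unique.map⁺ ⊕-injective (DecUnique.deduplicate-! _≟_ E)) (premise⁺ q t∈q)

  remaining-∷-∉ : ∀ {D t} q → t ∉ premise q → remaining (t ∷ D) q ≡ remaining D q
  remaining-∷-∉ q t∉q = cong length (∖-∷-∉ (t∉q ∘ premise⁻ q))

  remaining≡0⇒⊆ : ∀ {D} q → remaining D q ≡ 0 → premise q ⊆ D
  remaining≡0⇒⊆ q eq = length-∖⇒⊆ eq ∘ premise⁺ q

  ⊆⇒remaining≡0 : ∀ {D} q → premise q ⊆ D → remaining D q ≡ 0
  ⊆⇒remaining≡0 q q⊆D = ⊆⇒length-∖ (q⊆D ∘ premise⁻ q)

  -- The least set containing `A` and closed under the initialised pairs. It describes the members
  -- of `M` independently of the execution, so soundness, the finite bound on executions and the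
  -- lower bound `l A` are all proved by induction on it.
  data Forced : Timed n → Set where
    given : ∀ {t} → t ∈ A → Forced t
    fired : ∀ {q t} → q ∈ pairs → (∀ {s} → s ∈ premise q → Forced s) →
            t ∈ conclusion q → Forced t

  -- D is the list of the time points removed from update so far, and rest the part
  -- of the list of the last one that has not been treated yet.
  record Invariant (D : FinSet n) (rest : List Pair) (s : State) : Set where
    open State s
    field
      A⊆M       : A ⊆ M
      M-forced  : ∀ {t} → t ∈ M → Forced t
      D⊆M       : D ⊆ M
      update⊆M  : update ⊆ M
      M⊆D∪      : M ⊆ D ∪ update
      disjoint  : ∀ {t} → t ∈ update → t ∉ D
      pending   : ∀ {q} → q ∈ rest → count q ≡ suc (remaining D q)
      settled   : ∀ {q} → q ∈ pairs → q ∉ rest → count q ≡ remaining D q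
      closed    : ∀ {q} → q ∈ pairs → q ∉ rest → premise q ⊆ D → conclusion q ⊆ M

  initial-invariant : (∀ {q} → q ∈ pairs → premise q ≢ []) → Invariant [] [] initial
  initial-invariant nonempty = record
    { A⊆M      = id
    ; M-forced = given
    ; D⊆M      = λ ()
    ; update⊆M = id
    ; M⊆D∪     = id
    ; disjoint = λ _ ()
    ; pending  = λ ()
    ; settled  = λ { {(E ⇒ F) , i} _ _ → sym (remaining-[] E F i) }
    -- A pair with an empty premise would occur in no `list` and never fire, although its premise is
    -- contained in `D` from the start.
    ; closed   = λ q∈pairs _ q⊆[] → contradiction (⊆[]⇒≡[] q⊆[]) (nonempty q∈pairs)
    }

  -- Preservation of the invariant

  ≔-other : ∀ f {p q} c → q ≢ p → (f [ p ≔ c ]) q ≡ f q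
  ≔-other f {p} {q} c q≢p with q ≟ᵖ p
  ... | yes q≡p = contradiction q≡p q≢p
  ... | no  _   = refl

  private
    new : State → Pair → FinSet n
    new s p = conclusion p ∖ State.M s

  visit-zero : ∀ s p → pred (State.count s p) ≡ 0 →
    visit s p ≡
      state (State.count s [ p ≔ 0 ]) (State.M s ∪ new s p) (State.update s ∪ new s p)
  visit-zero s p eq rewrite eq = refl

  visit-suc : ∀ s p {c} → pred (State.count s p) ≡ suc c →
    visit s p ≡ state (State.count s [ p ≔ suc c ]) (State.M s) (State.update s)
  visit-suc s p eq rewrite eq = refl

  -- The decremented counter of `p` is exactly `remaining D p`. If it is zero, the whole premise
  -- lies in `D`, hence in `M`, and firing is legitimate; otherwise the premise is not contained in
  -- `D`, so `closed` demands nothing of `p`. Since `p ∉ ps`, the new entry disturbs no counter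
  -- still pending.
  visit-invariant : ∀ {D p ps s} → p ∈ pairs → p ∉ ps →
                    Invariant D (p ∷ ps) s → Invariant D ps (visit s p)
  visit-invariant {D} {p} {ps} {s} p∈pairs p∉ps inv = go (remaining D p) refl
    where
    open State s
    open Invariant inv

    pred-count : pred (count p) ≡ remaining D p
    pred-count = cong pred (pending (here refl))

    ∉-∷ : ∀ {q} → q ≢ p → q ∉ ps → q ∉ p ∷ ps
    ∉-∷ q≢p q∉ps (here q≡p)   = q≢p q≡p
    ∉-∷ q≢p q∉ps (there q∈ps) = q∉ps q∈ps

    pending′ : ∀ {c q} → q ∈ ps → (count [ p ≔ c ]) q ≡ suc (remaining D q)
    pending′ {c} q∈ps =
      trans (≔-other count c λ { refl → p∉ps q∈ps }) (pending (there q∈ps))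

    settled′ : ∀ {c q} → remaining D p ≡ c → q ∈ pairs → q ∉ ps →
               (count [ p ≔ c ]) q ≡ remaining D q
    settled′ {c} {q} eq q∈pairs q∉ps with q ≟ᵖ p
    ... | yes refl = sym eq
    ... | no  q≢p  = settled q∈pairs (∉-∷ q≢p q∉ps)

    go : ∀ r → remaining D p ≡ r → Invariant D ps (visit s p)
    go zero eq = subst (Invariant D ps) (sym (visit-zero s p (trans pred-count eq))) record
      { A⊆M      = ∈-++⁺ˡ ∘ A⊆M
      ; M-forced = [ M-forced
                   , fired p∈pairs (M-forced ∘ D⊆M ∘ remaining≡0⇒⊆ p eq) ∘ proj₁ ∘ new⁻
                   ]′ ∘ ∈-++⁻ M
      ; D⊆M      = ∈-++⁺ˡ ∘ D⊆M
      ; update⊆M = [ ∈-++⁺ˡ ∘ update⊆M , ∈-++⁺ʳ M ]′ ∘ ∈-++⁻ update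
      ; M⊆D∪     = [ [ ∈-++⁺ˡ , ∈-++⁺ʳ D ∘ ∈-++⁺ˡ ]′ ∘ ∈-++⁻ D ∘ M⊆D∪
                   , ∈-++⁺ʳ D ∘ ∈-++⁺ʳ update ]′ ∘ ∈-++⁻ M
      -- `new` avoids `M`, which contains `D`: no time point is scheduled again after its visit.
      ; disjoint = [ disjoint , (λ t∈new → proj₂ (new⁻ t∈new) ∘ D⊆M) ]′ ∘ ∈-++⁻ update
      ; pending  = pending′
      ; settled  = settled′ eq
      ; closed   = closed′
      }
      where
      new⁻ : ∀ {t} → t ∈ new s p → t ∈ conclusion p × t ∉ M
      new⁻ = ∈-∖⁻ {M = conclusion p}

      conclusion⊆ : conclusion p ⊆ M ∪ new s p
      conclusion⊆ {t} t∈ with t ∈? M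
      ... | yes t∈M = ∈-++⁺ˡ t∈M
      ... | no  t∉M = ∈-++⁺ʳ M (∈-∖⁺ t∈ t∉M)

      closed′ : ∀ {q} → q ∈ pairs → q ∉ ps → premise q ⊆ D → conclusion q ⊆ M ∪ new s p
      closed′ {q} q∈pairs q∉ps q⊆D with q ≟ᵖ p
      ... | yes refl = conclusion⊆
      ... | no  q≢p  = ∈-++⁺ˡ ∘ closed q∈pairs (∉-∷ q≢p q∉ps) q⊆D
    go (suc r) eq = subst (Invariant D ps) (sym (visit-suc s p (trans pred-count eq))) record
      { A⊆M      = A⊆M
      ; M-forced = M-forced
      ; D⊆M      = D⊆M
      ; update⊆M = update⊆M
      ; M⊆D∪     = M⊆D∪
      ; disjoint = disjoint
      ; pending  = pending′
      ; settled  = settled′ eq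
      ; closed   = closed′
      }
      where
      closed′ : ∀ {q} → q ∈ pairs → q ∉ ps → premise q ⊆ D → conclusion q ⊆ M
      closed′ {q} q∈pairs q∉ps q⊆D with q ≟ᵖ p
      ... | yes refl = contradiction (trans (sym eq) (⊆⇒remaining≡0 q q⊆D)) λ ()
      ... | no  q≢p  = closed q∈pairs (∉-∷ q≢p q∉ps) q⊆D

  visits-invariant : ∀ {D s} ps → ps ⊆ pairs → Unique ps →
                     Invariant D ps s → Invariant D [] (foldl visit s ps)
  visits-invariant []       _        _               inv = inv
  visits-invariant (p ∷ ps) ps⊆pairs ps!@(_ ∷ ps!′) inv =
    visits-invariant ps (ps⊆pairs ∘ there) ps!′
      (visit-invariant (ps⊆pairs (here refl)) (Unique.Unique[x∷xs]⇒x∉xs ps!) inv)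

  -- Moving `t` into `D` lowers `remaining` by one for exactly the pairs in `list t`, while `count`
  -- is unchanged. These pairs become pending, with a counter that is one too large; for all others
  -- nothing changes.
  take-invariant : ∀ {D count M update t ps} → t ∈ update → ps ↭ list t →
                   Invariant D [] (state count M update) →
                   Invariant (t ∷ D) ps (state count M (update ∖ (t ∷ [])))
  take-invariant {D} {count} {M} {update} {t} {ps} t∈update ps↭list inv = record
    { A⊆M      = A⊆M
    ; M-forced = M-forced
    ; D⊆M      = ∈-∷⁺ʳ (update⊆M t∈update) D⊆M
    ; update⊆M = update⊆M ∘ proj₁ ∘ rest⁻
    ; M⊆D∪     = M⊆D∪′
    ; disjoint = λ { s∈rest (here refl) → proj₂ (rest⁻ s∈rest) (here refl)
                   ; s∈rest (there s∈D) → disjoint (proj₁ (rest⁻ s∈rest)) s∈D }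
    ; pending  = λ {q} q∈ps →
        let q∈pairs , t∈q = ∈-list⁻ (∈-resp-↭ ps↭list q∈ps)
        in trans (settled q∈pairs λ ()) (remaining-∷-∈ q t∈q (disjoint t∈update))
    ; settled  = λ {q} q∈pairs q∉ps →
        trans (settled q∈pairs λ ()) (sym (remaining-∷-∉ q (∉-premise q∈pairs q∉ps)))
    ; closed   = λ q∈pairs q∉ps q⊆t∷D →
        closed q∈pairs (λ ()) λ s∈q →
          strip (q⊆t∷D s∈q) λ { refl → ∉-premise q∈pairs q∉ps s∈q }
    }
    where
    open Invariant inv

    rest⁻ : ∀ {s} → s ∈ update ∖ (t ∷ []) → s ∈ update × s ∉ t ∷ []
    rest⁻ = ∈-∖⁻ {M = update}

    strip : ∀ {s} {N : FinSet n} → s ∈ t ∷ N → s ≢ t → s ∈ N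
    strip (here s≡t)  s≢t = contradiction s≡t s≢t
    strip (there s∈N) _   = s∈N

    M⊆D∪′ : M ⊆ (t ∷ D) ∪ (update ∖ (t ∷ []))
    M⊆D∪′ {s} s∈M with s ≟ t | ∈-++⁻ D (M⊆D∪ s∈M)
    ... | yes refl | _             = here refl
    ... | no _     | inj₁ s∈D      = there (∈-++⁺ˡ s∈D)
    ... | no s≢t   | inj₂ s∈update =
      there (∈-++⁺ʳ D (∈-∖⁺ s∈update λ { (here s≡t) → s≢t s≡t }))

    ∉-premise : ∀ {q} → q ∈ pairs → q ∉ ps → t ∉ premise q
    ∉-premise q∈pairs q∉ps t∈q = q∉ps (∈-resp-↭ (↭-sym ps↭list) (∈-list⁺ q∈pairs t∈q))

  -- The visited time point is returned as forced and new to `D`: this is what the termination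
  -- measure needs.
  step-invariant : ∀ {D s s′} → Invariant D [] s → s ⟶ s′ →
                   ∃ λ t → Forced t × t ∉ D × Invariant (t ∷ D) [] s′
  step-invariant inv (iterate {t = t} {ps} t∈update ps↭list) =
    t , M-forced (update⊆M t∈update) , disjoint t∈update ,
    visits-invariant ps (proj₁ ∘ ∈-list⁻ ∘ ∈-resp-↭ ps↭list)
      (Permutation.Unique-resp-↭ (setoid Pair) (↭⇒↭ₛ (↭-sym ps↭list)) (list-unique t))
      (take-invariant t∈update ps↭list inv)
    where open Invariant inv

  steps-invariant : ∀ {D s s′} → Invariant D [] s → Star _⟶_ s s′ →
                    ∃ λ D′ → Invariant D′ [] s′
  steps-invariant inv ε              = _ , inv
  steps-invariant inv (step ◅ steps) with step-invariant inv step
  ... | _ , _ , _ , inv′ = steps-invariant inv′ steps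

  -- Termination

  universe : FinSet n
  universe = deduplicate _≟_ (A ∪ concatMap conclusion pairs)

  Forced⇒∈universe : ∀ {t} → Forced t → t ∈ universe
  Forced⇒∈universe (given t∈A) = ∈-deduplicate⁺ _≟_ (∈-++⁺ˡ t∈A)
  Forced⇒∈universe (fired q∈pairs _ t∈q) =
    ∈-deduplicate⁺ _≟_ (∈-++⁺ʳ A (∈-concatMap⁺ conclusion (lose q∈pairs t∈q)))

  -- The measure is the number of elements of `universe` not yet visited. It is named `k` so that
  -- the recursion is structural.
  invariant⇒acc : ∀ {D s} k → length (universe ∖ D) ≡ k → Invariant D [] s → Acc (flip _⟶_) s
  invariant⇒acc {D} k eq inv = acc λ step → go k eq (step-invariant inv step)
    where
    go : ∀ {s} k → length (universe ∖ D) ≡ k →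
         (∃ λ t → Forced t × t ∉ D × Invariant (t ∷ D) [] s) → Acc (flip _⟶_) s
    go k eq (t , t-forced , t∉D , inv′)
      with trans (sym eq)
             (length-∖-∷ (DecUnique.deduplicate-! _≟_ _) (Forced⇒∈universe t-forced) t∉D)
    -- The case of measure zero is impossible: `t` itself is an unvisited element of `universe`.
    go (suc k) eq (t , t-forced , t∉D , inv′) | k≡ =
      invariant⇒acc k (sym (ℕ.suc-injective k≡)) inv′

  -- Some complete execution exists: always take the head of `update` and treat its list in the
  -- given order.
  acc⇒halts : ∀ {s} → Acc (flip _⟶_) s → ∃ λ R → ∃ λ count → Star _⟶_ s (state count R [])
  acc⇒halts {state count M []}      _         = M , count , ε
  acc⇒halts {state count M (t ∷ _)} (acc rec) =
    let step = iterate (here refl) ↭-refl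
        R , count′ , steps = acc⇒halts (rec step)
    in R , count′ , step ◅ steps

  -- Making everything after `Max` true validates the shifts cut off by the upper bound in `pairs`,
  -- whose conclusions lie entirely after `Max`.
  Model : FinSet n → Timed n → Set
  Model R t = t ∈ R ⊎ Max < proj₂ t

  -- Correctness for predictive theories

  module _ (predictive : PredictiveTheory ⟦ Σ ⟧) where

    private
      pair-predictive : ∀ {E F i} → ((E ⇒ F) , i) ∈ pairs → Predictive (E ⇒ F)
      pair-predictive q∈pairs = predictive _ (proj₁ (∈-pairs⁻ q∈pairs))

    premise-nonempty : ∀ {q} → q ∈ pairs → premise q ≢ []
    premise-nonempty {([]    ⇒ _) , _} q∈pairs _ = proj₁ (pair-predictive q∈pairs) refl
    premise-nonempty {(_ ∷ _ ⇒ _) , _} _       ()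

    start : Invariant [] [] initial
    start = initial-invariant premise-nonempty

    terminates : Terminates
    terminates = invariant⇒acc _ refl start

    returns : ∃ λ R → Returns R
    returns = acc⇒halts terminates

    -- The derivations of the single premises are joined into one of `E ⊕ i`, followed by the
    -- shifted hypothesis and an axiom that selects `t`.
    Forced⇒⊢ : ∀ {t} → Forced t → ⟦ Σ ⟧ ⊢ (A ⇒ t ∷ [])
    Forced⇒⊢ (given t∈A) = ⊢-⊆ λ { (here refl) → t∈A }
    Forced⇒⊢ (fired {(E ⇒ F) , i} q∈pairs forced t∈q) =
      ⊢-trans (⊢-pointwise (E ⊕ i) (λ s∈q → Forced⇒⊢ (forced s∈q)))
        (⊢-trans (⊢-shift i (⊢-hyp (proj₁ (∈-pairs⁻ q∈pairs))))
                 (⊢-⊆ λ { (here refl) → t∈q }))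

    -- The lower bound on `i` in `pairs` puts `E + i` at `l A` or later, and predictivity puts
    -- `F + i` no earlier than that. Hence this bound excludes no shift whose premises are all
    -- forced.
    Forced⇒≥l : ∀ {y j} → Forced (y , j) → l A ≤ j
    Forced⇒≥l (given t∈A) = l-≤ t∈A
    Forced⇒≥l (fired {(E ⇒ F) , i} q∈pairs _ t∈q) with ∈-⊕⁻ t∈q | pair-predictive q∈pairs
    ... | y , j , y∈F , refl | E≢[] , _ , E≤F = begin
      l A      ≤⟨ i-j≤k⇒i≤j+k (l E) (proj₂ (∈-pairs⁻ q∈pairs)) ⟩
      l E + i  ≤⟨ ℤ.+-monoˡ-≤ i (E≤F (proj₂ (l-∈ E≢[])) y∈F) ⟩
      j + i    ∎
      where open ℤ.≤-Reasoning

    module _ {R : FinSet n} (R-returned : Returns R) where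

      private
        final : ∃ λ D → Invariant D [] (state (proj₁ R-returned) R [])
        final = steps-invariant start (proj₂ R-returned)

        open Invariant (proj₂ final)

      returned-closed : ∀ {q} → q ∈ pairs → premise q ⊆ R → conclusion q ⊆ R
      returned-closed q∈pairs q⊆R =
        -- As `update` is empty, `M⊆D∪` says that every member of `R` has been visited.
        closed q∈pairs (λ ()) (subst (_ ∈_) (++-identityʳ _) ∘ M⊆D∪ ∘ q⊆R)

      returned-forced : ∀ {t} → t ∈ R → Forced t
      returned-forced = M-forced

      A⊆returned : A ⊆ R
      A⊆returned = A⊆M

    returned-model : ∀ {R φ} → l A ≤ Max → Returns R → φ ∈ Σ → Model R ⊨ φ
    returned-model {R} {φ} lA≤Max R-returned φ∈Σ with representative φ∈Σ
    ... | (E ⇒ F) , ψ∈ , φ≈ψ = ⊨-resp-≈ {N = Model R} {φ} {E ⇒ F} φ≈ψ E⇒F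
      where
      E⇒F-predictive : Predictive (E ⇒ F)
      E⇒F-predictive = predictive _ (∈-deduplicate⁻ _≈?_ Σ ψ∈)

      E≢[] : E ≢ []
      E≢[] = proj₁ E⇒F-predictive

      F≢[] : F ≢ []
      F≢[] = proj₁ (proj₂ E⇒F-predictive)

      E≤lF : ∀ {x j} → (x , j) ∈ E → j ≤ l F
      E≤lF x∈E = proj₂ (proj₂ E⇒F-predictive) x∈E (proj₂ (l-∈ F≢[]))

      -- Needed for the lower bound on `i` in `pairs`; `lA≤Max` covers the time points adjoined
      -- after `Max`.
      Model⇒≥lA : ∀ {y j} → Model R (y , j) → l A ≤ j
      Model⇒≥lA (inj₁ t∈R)   = Forced⇒≥l (returned-forced R-returned t∈R)
      Model⇒≥lA (inj₂ Max<j) = ℤ.≤-trans lA≤Max (ℤ.<⇒≤ Max<j)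

      E⇒F : Model R ⊨ (E ⇒ F)
      E⇒F i R⊨E {y} {j} y∈F with l F + i ℤ.≤? Max
      ... | no  lF+i≰Max = inj₂ (ℤ.<-≤-trans (ℤ.≰⇒> lF+i≰Max) (ℤ.+-monoˡ-≤ i (l-≤ y∈F)))
      ... | yes lF+i≤Max = inj₁ (returned-closed R-returned q∈pairs E+i⊆R (∈-map⁺ _ y∈F))
        where
        q∈pairs : ((E ⇒ F) , i) ∈ pairs
        q∈pairs = ∈-pairs⁺ ψ∈
          (i≤j+k⇒i-j≤k (l E) (Model⇒≥lA (R⊨E (proj₂ (l-∈ E≢[])))))
          (i+j≤k⇒j≤k-i (l F) lF+i≤Max)

        E+i⊆R : E ⊕ i ⊆ R
        E+i⊆R t∈E+i with ∈-⊕⁻ t∈E+i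
        ... | x , k , x∈E , refl = [ id , later ]′ (R⊨E x∈E)
          where
          later : Max < k + i → (x , k + i) ∈ R
          -- By predictivity, `k + i` is at most `l F + i`, hence at most `Max`.
          later Max<k+i = contradiction
            (ℤ.≤-trans (ℤ.+-monoˡ-≤ i (E≤lF x∈E)) lF+i≤Max) (ℤ.<⇒≱ Max<k+i)

theorem16 : ∀ {n} .{{_ : NonZero n}} (Σ : List (Formula n)) (A B : FinSet n) →
    PredictiveTheory ⟦ Σ ⟧ → Predictive (A ⇒ B) →
    PseudoLinClosure.Terminates Σ A (u B) ×
    (∃ λ M → PseudoLinClosure.Returns Σ A (u B) M) ×
    (∀ M → PseudoLinClosure.Returns Σ A (u B) M → (⟦ Σ ⟧ ⊢ (A ⇒ B)) ⇔ (B ⊆ M))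
theorem16 {n} Σ A B predictive (A≢[] , B≢[] , A≤B) =
  terminates predictive ,
  returns predictive ,
  λ M returned → mk⇔ (complete returned) (sound returned)
  where
  open Execution Σ A (u B)

  lA≤uB : l A ≤ u B
  lA≤uB = ℤ.≤-trans (A≤B (proj₂ (l-∈ A≢[])) y∈B) (≤-u y∈B)
    where y∈B = proj₂ (l-∈ B≢[])

  complete : ∀ {M} → PseudoLinClosure.Returns Σ A (u B) M → ⟦ Σ ⟧ ⊢ (A ⇒ B) → B ⊆ M
  complete {M} returned A⊢B {y , j} t∈B =
    -- Truth of `A ⇒ B` in the model is used at shift 0, where `A` holds because it is contained in
    -- `M`. What follows for a member of `B` cannot come from the part after `u B`.
    [ id , (λ later → contradiction (≤-u t∈B) (ℤ.<⇒≱ later)) ]′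
      (subst (λ k → Model M (y , k)) (ℤ.+-identityʳ j)
        (⊢⇒⊨ {N = Model M} (returned-model predictive lA≤uB returned) {A ⇒ B} A⊢B 0ℤ
          (λ {x} {k} x∈A → inj₁ (subst (λ m → (x , m) ∈ M) (sym (ℤ.+-identityʳ k))
                                   (A⊆returned predictive returned x∈A)))
          t∈B))

  sound : ∀ {M} → PseudoLinClosure.Returns Σ A (u B) M → B ⊆ M → ⟦ Σ ⟧ ⊢ (A ⇒ B)
  sound returned B⊆M =
    ⊢-pointwise B λ t∈B → Forced⇒⊢ predictive (returned-forced predictive returned (B⊆M t∈B))
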